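{- There is an absolute constant $c>0$ such that for all integers $n>1$ and $1<k\le\binom{n-1}{\lfloor(n-1)/2\rfloor}$, $C_{\mathrm{NGBW}}(n,k)\ge(cnk)^n$; that is, $C_{\mathrm{NGBW}}(n,k)=(\Omega(nk))^n$.
   Context: An NGBW is $(\Sigma,S,I,\Delta,\{F_1,\dots,F_k\})$ with finite alphabet, finite state set $S$, $I\subseteq S$, $\Delta\subseteq S\times\Sigma\times S$, $F_i\subseteq S$; $k$ is its index. A run over $\alpha\in\Sigma^\omega$ is $\rho(0)\rho(1)\cdots$ with $\rho(0)\in I$, $\langle\rho(i),\alpha(i),\rho(i+1)\rangle\in\Delta$; it is successful if each $F_i$ contains a state occurring infinitely often in $\rho$; $\mathcal{L}(\mathcal{A})$ is the set of $\omega$-words with a successful run. $C_{\mathrm{NGBW}}(\mathcal{A})$ is the minimum number of states of an NGBW over $\Sigma$ accepting $\Sigma^\omega\setminus\mathcal{L}(\mathcal{A})$, and $C_{\mathrm{NGBW}}(n,k)$ is the maximum of $C_{\mathrm{NGBW}}(\mathcal{A})$ over NGBWs $\mathcal{A}$ with $n$ states and index $k$. -}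

module Defs where

open import Data.Nat using (ℕ; _≤_; _<_; _+_; _*_; _^_; _∸_; _/_)
open import Data.Nat.Combinatorics using (_C_)
open import Data.Fin using (Fin)
open import Data.Bool using (Bool; true)
open import Data.Product using (Σ; ∃; _×_)
open import Relation.Binary.PropositionalEquality using (_≡_)
open import Relation.Nullary using (¬_)

-- A nondeterministic generalized Büchi word automaton (NGBW) over the
-- finite alphabet Fin m, with state set Fin n and index k
-- (acceptance sets F₀ … F_{k-1}).  Subsets are given by characteristic
-- Boolean functions.
record NGBW (m n k : ℕ) : Set where
  field
    initial : Fin n → Bool
    trans   : Fin n → Fin m → Fin n → Bool
    accSet  : Fin k → Fin n → Bool

open NGBW public

Word : ℕ → Set
Word m = ℕ → Fin m

IsRun : ∀ {m n k} → NGBW m n k → Word m → (ℕ → Fin n) → Set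
IsRun A α ρ = (initial A (ρ 0) ≡ true)
            × (∀ i → trans A (ρ i) (α i) (ρ (Data.Nat.suc i)) ≡ true)

InfOftenIn : ∀ {n} → (Fin n → Bool) → (ℕ → Fin n) → Set
InfOftenIn F ρ = ∀ i → Σ ℕ λ j → (i ≤ j) × (F (ρ j) ≡ true)

Successful : ∀ {m n k} → NGBW m n k → (ℕ → Fin n) → Set
Successful A ρ = ∀ (f : Fin _) → InfOftenIn (accSet A f) ρ

Accepts : ∀ {m n k} → NGBW m n k → Word m → Set
Accepts {n = n} A α = Σ (ℕ → Fin n) λ ρ → IsRun A α ρ × Successful A ρ

AcceptsComplementOf : ∀ {m s k' n k} → NGBW m s k' → NGBW m n k → Set
AcceptsComplementOf B A =
  ∀ (α : Word _) → (Accepts B α → ¬ Accepts A α) × (¬ Accepts A α → Accepts B α)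

{-# OPTIONS --safe #-}
module Submission where

-- The bound combines Michel's permutations with a family of pairwise qualitatively
-- independent sets G l.  The acceptance sets are the G l and their complements.  A code is
-- a linear order on the N = n - 2 home states together with a label h x for each home
-- state x, and its word u lets every home state x return to itself after visiting
-- exactly the home states on the same side of G (h x) as x itself: by independence such a
-- path meets all acceptance sets but the other side of G (h x).  Moreover u leads from x
-- to every y of smaller rank through a state lying in all acceptance sets.  So u^ω is
-- rejected, as the rank of a run cannot decrease forever, but a cycle composed of the words
-- of two different codes is accepted: either both orders are traversed downwards, or the
-- two labels of some x miss different acceptance sets.  If an automaton for the complement
-- reached a common state on the loops of two codes, it would accept such a mixture.  Hence
-- it has at least N! K^N states, where K is the number of sets G l.

open import Defs
open import Data.Bool using (Bool; true; false; not)
import Data.Bool.Properties as Bool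
open import Data.Empty using (⊥)
open import Data.Fin using (Fin; zero; suc; toℕ)
import Data.Fin as Fin
open import Data.Fin.Permutation using (Permutation′; insert; insert-punchIn; inverseʳ; _⟨$⟩ʳ_; _⟨$⟩ˡ_)
import Data.Fin.Permutation as Permutation
import Data.Fin.Properties as Fin
open import Data.Fin.Subset using (Subset; inside; outside; ∣_∣)
import Data.Fin.Subset as Subset
open import Data.Fin.Subset.Properties using (∣⊥∣≡0)
open import Data.List using (List; []; _∷_; _++_; length; filter; cartesianProductWith; allFin)
import Data.List as List
open import Data.List.Membership.Propositional using (_∈_)
open import Data.List.Membership.Propositional.Properties
  using (∈-filter⁺; ∈-++⁺ˡ; ∈-++⁺ʳ; ∈-cartesianProductWith⁺; ∈-allFin; ∈-map⁻; ∈-lookup)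
import Data.List.Properties as List
open import Data.List.Relation.Unary.All using (All; []; _∷_)
import Data.List.Relation.Unary.All as All
import Data.List.Relation.Unary.All.Properties as All
open import Data.List.Relation.Unary.AllPairs using ([]; _∷_)
open import Data.List.Relation.Unary.Any using (here; there)
open import Data.List.Relation.Unary.Unique.Propositional using (Unique)
import Data.List.Relation.Unary.Unique.Propositional.Properties as Unique
open import Data.Nat using (ℕ; zero; suc; _+_; _≤_; _<_; _*_; _^_; _∸_; _/_; _%_; _!; _⊓_; z≤n; s≤s)
open import Data.Nat.Combinatorics using (_C_; nC1≡n; nCk+nC[k+1]≡[n+1]C[k+1])
open import Data.Nat.DivMod using (m≡m%n+[m/n]*n; m%n<n; m/n*n≤m; m/n≡1+[m∸n]/n)
open import Data.Nat.Properties
open import Data.Nat.Tactic.RingSolver using (solve-∀)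
open import Data.Product using (Σ; ∃; _×_; _,_; proj₁; proj₂)
open import Data.Sum using (_⊎_; inj₁; inj₂)
open import Data.Vec using ([]; _∷_; lookup)
open import Data.Vec.Properties using (∷-injectiveʳ)
open import Function using (_∘_)
open import Function.Bundles using (Inverse)
open import Relation.Binary using (tri<; tri≈; tri>)
open import Relation.Binary.PropositionalEquality renaming (trans to ≡-trans)
open import Relation.Nullary using (¬_; Dec; yes; no; does; contradiction)
open import Relation.Nullary.Decidable using (dec-true)
open import Relation.Unary using (Decidable)

-- Finite paths, lassos and fooling sets

data Path {m n k} (A : NGBW m n k) : Fin n → List (Fin m) → Fin n → Set where
  []  : ∀ {x} → Path A x [] x
  _∷_ : ∀ {x y z a u} → trans A x a y ≡ true → Path A y u z → Path A x (a ∷ u) z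

-- Only targets of edges count, not the start of the path. Visits therefore survive concatenation on
-- both sides, and a nonempty closed path still counts all its states.
data Visits {m n k} {A : NGBW m n k} (F : Fin n → Bool) :
            ∀ {x u z} → Path A x u z → Set where
  here  : ∀ {x y z a u} {e : trans A x a y ≡ true} {p : Path A y u z} →
          F y ≡ true → Visits F (e ∷ p)
  there : ∀ {x y z a u} {e : trans A x a y ≡ true} {p : Path A y u z} →
          Visits F p → Visits F (e ∷ p)

module _ {m n k : ℕ} {A : NGBW m n k} where

  infixr 5 _++ᵖ_

  _++ᵖ_ : ∀ {x y z u v} → Path A x u y → Path A y v z → Path A x (u ++ v) z
  []      ++ᵖ q = q
  (e ∷ p) ++ᵖ q = e ∷ (p ++ᵖ q)

  visits-++ˡ : ∀ {F x y z u v} {p : Path A x u y} (q : Path A y v z) →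
               Visits F p → Visits F (p ++ᵖ q)
  visits-++ˡ q (here h)  = here h
  visits-++ˡ q (there h) = there (visits-++ˡ q h)

  visits-++ʳ : ∀ {F x y z u v} (p : Path A x u y) {q : Path A y v z} →
               Visits F q → Visits F (p ++ᵖ q)
  visits-++ʳ []      h = h
  visits-++ʳ (e ∷ p) h = there (visits-++ʳ p h)

Lap : ∀ {m n k} → NGBW m n k → Fin n → List (Fin m) → Fin n → Set
Lap A x u z = Σ (Path A x u z) λ p → ∀ f → Visits (accSet A f) p

-- ω u a v is the word u (a v)^ω.
ω : ∀ {X : Set} → List X → X → List X → ℕ → X
ω []      a v zero    = a
ω []      a v (suc t) = ω v a v t
ω (b ∷ u) a v zero    = b
ω (b ∷ u) a v (suc t) = ω u a v t

module _ {m n k : ℕ} {A : NGBW m n k} {y z : Fin n} {a : Fin m} {v : List (Fin m)}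
         (edge : trans A z a y ≡ true) (back : Path A y v z) where

  -- The path argument is what remains before `z`. Once it is used up, `edge` leads into `back` and
  -- the cycle begins anew.
  lassoRun : ∀ {x u} → Path A x u z → ℕ → Fin n
  lassoRun {x} p   zero    = x
  lassoRun []      (suc t) = lassoRun back t
  lassoRun (e ∷ p) (suc t) = lassoRun p t

  lassoRun-trans : ∀ {x u} (p : Path A x u z) t →
                   trans A (lassoRun p t) (ω u a v t) (lassoRun p (suc t)) ≡ true
  lassoRun-trans []      zero    = edge
  lassoRun-trans []      (suc t) = lassoRun-trans back t
  lassoRun-trans (e ∷ p) zero    = e
  lassoRun-trans (e ∷ p) (suc t) = lassoRun-trans p t

  module _ {F : Fin n → Bool} (visits : Visits F (edge ∷ back)) where

    visit-position : ∀ {x u} {p : Path A x u z} → Visits F p →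
                     Σ ℕ λ j → F (lassoRun p (suc j)) ≡ true
    visit-position (here h)  = 0 , h
    visit-position (there h) with visit-position h
    ... | j , h′ = suc j , h′

    visit-after : ∀ {x u} (p : Path A x u z) → Σ ℕ λ j → F (lassoRun p j) ≡ true
    visit-after [] with visit-position visits
    ... | j , h = suc j , h
    visit-after (e ∷ p) with visit-after p
    ... | j , h = suc j , h

    lassoRun-infOften : ∀ {x u} (p : Path A x u z) → InfOftenIn F (lassoRun p)
    lassoRun-infOften p zero with visit-after p
    ... | j , h = j , z≤n , h
    lassoRun-infOften [] (suc i) with lassoRun-infOften back i
    ... | j , le , h = suc j , s≤s le , h
    lassoRun-infOften (e ∷ p) (suc i) with lassoRun-infOften p i
    ... | j , le , h = suc j , s≤s le , h

lasso-accepts : ∀ {m n k} {A : NGBW m n k} {x z u a v} → initial A x ≡ true →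
                Path A x u z → Lap A z (a ∷ v) z → Accepts A (ω u a v)
lasso-accepts init p (edge ∷ back , visits) =
  lassoRun edge back p , (init , lassoRun-trans edge back p) ,
  λ f → lassoRun-infOften edge back (visits f) p

-- Laps over periodic words, and splicing them

repeat : ∀ {X : Set} → ℕ → List X → List X
repeat zero    w = []
repeat (suc b) w = w ++ repeat b w

repeat-+ : ∀ {X : Set} b c (w : List X) → repeat b w ++ repeat c w ≡ repeat (b + c) w
repeat-+ zero    c w = refl
repeat-+ (suc b) c w = ≡-trans (List.++-assoc w (repeat b w) (repeat c w)) (cong (w ++_) (repeat-+ b c w))

n≤length-repeat : ∀ {X : Set} b (a : X) v → b ≤ length (repeat b (a ∷ v))
n≤length-repeat zero    a v = z≤n
n≤length-repeat (suc b) a v = s≤s (≤-trans (n≤length-repeat b a v)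
  (≤-trans (m≤n+m _ (length v)) (≤-reflexive (sym (List.length-++ v)))))

ω-++ : ∀ {X : Set} {a : X} {v u} → ω u a v ≗ ω [] a v → ∀ x → ω (x ++ u) a v ≗ ω x a v
ω-++ h []      i       = h i
ω-++ h (b ∷ x) zero    = refl
ω-++ h (b ∷ x) (suc i) = ω-++ h x i

ω-unroll : ∀ {X : Set} (a : X) v → ω (a ∷ v) a v ≗ ω [] a v
ω-unroll a v zero    = refl
ω-unroll a v (suc i) = refl

ω-repeat : ∀ {X : Set} (a : X) v b → ω (repeat b (a ∷ v)) a v ≗ ω [] a v
ω-repeat a v zero    i = refl
ω-repeat a v (suc b) i =
  ≡-trans (ω-++ (ω-repeat a v b) (a ∷ v) i) (ω-unroll a v i)

Follows : ∀ {m n k} → NGBW m n k → (ℕ → Fin n) → Word m → Set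
Follows A ρ α = ∀ i → trans A (ρ i) (α i) (ρ (suc i)) ≡ true

Fin-bound : ∀ {n} (j : Fin n → ℕ) → Σ ℕ λ b → ∀ f → j f ≤ b
Fin-bound {zero}  j = 0 , λ ()
Fin-bound {suc n} j with Fin-bound (j ∘ suc)
... | b , h = j zero + b , λ where
  zero    → m≤m+n _ _
  (suc f) → ≤-trans (h f) (m≤n+m _ _)

module _ {m n k : ℕ} (A : NGBW m n k) (a : Fin m) (v : List (Fin m)) where

  Follows-cong : ∀ {ρ α β} → α ≗ β → Follows A ρ α → Follows A ρ β
  Follows-cong {ρ} eq h i = subst (λ b → trans A (ρ i) b (ρ (suc i)) ≡ true) (eq i) (h i)

  takePath : ∀ u {ρ} → Follows A ρ (ω u a v) → Path A (ρ 0) u (ρ (length u))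
  takePath []      h = []
  takePath (b ∷ u) h = h 0 ∷ takePath u (h ∘ suc)

  takePath-visits : ∀ {F} u {ρ} (h : Follows A ρ (ω u a v)) {j} → j < length u →
                    F (ρ (suc j)) ≡ true → Visits F (takePath u h)
  takePath-visits (b ∷ u) h {zero}  _         F∋ = here F∋
  takePath-visits (b ∷ u) h {suc j} (s≤s j<l) F∋ = there (takePath-visits u (h ∘ suc) j<l F∋)

  dropPath : ∀ u {ρ} → Follows A ρ (ω u a v) → Follows A (λ i → ρ (length u + i)) (ω [] a v)
  dropPath []      h = h
  dropPath (b ∷ u) h = dropPath u (h ∘ suc)

Successful-drop : ∀ {m n k} (A : NGBW m n k) {ρ} l → Successful A ρ → Successful A (λ i → ρ (l + i))
Successful-drop A {ρ} l succ f i with succ f (l + i)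
... | j , le , h = j ∸ l , m+n≤o⇒m≤o∸n i (≤-trans (≤-reflexive (+-comm i l)) le) ,
      subst (λ t → accSet A f (ρ t) ≡ true) (sym (m+[n∸m]≡n (≤-trans (m≤m+n l i) le))) h

module _ {m n k : ℕ} (A : NGBW m n k) (a : Fin m) (v : List (Fin m)) where

  -- The number of periods is `suc b`, so the word is nonempty and begins with `a`, as
  -- `lasso-accepts` requires of a cycle.
  Laps : Fin n → Fin n → Set
  Laps x y = Σ ℕ λ b → Lap A x (repeat (suc b) (a ∷ v)) y

  Laps-trans : ∀ {x y z} → Laps x y → Laps y z → Laps x z
  Laps-trans {x} {y} {z} (b , p , visits) (c , q , _) =
    b + suc c , subst (λ u → Lap A x u z) (repeat-+ (suc b) (suc c) (a ∷ v))
                  (p ++ᵖ q , λ f → visits-++ˡ q (visits f))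

  -- The start need not be initial, so that a run may be cut after any whole number of periods and
  -- what remains is of the same kind.
  record AcceptingTail : Set where
    field
      run     : ℕ → Fin n
      follows : Follows A run (ω [] a v)
      success : Successful A run

    start : Fin n
    start = run 0

    -- Visits are sought from position 1 on because `Visits` ignores the start. The finitely many
    -- acceptance sets have a common bound, and one period more than this bound reaches past all
    -- these visits.
    lastFirstVisit : Σ ℕ λ b → ∀ f → proj₁ (success f 1) ≤ b
    lastFirstVisit = Fin-bound λ f → proj₁ (success f 1)

    lapWord : List (Fin m)
    lapWord = repeat (suc (proj₁ lastFirstVisit)) (a ∷ v)

    followsLap : Follows A run (ω lapWord a v)
    followsLap = Follows-cong A a v (λ i → sym (ω-repeat a v (suc (proj₁ lastFirstVisit)) i)) follows

    laps : Laps start (run (length lapWord))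
    laps = proj₁ lastFirstVisit , takePath A a v lapWord followsLap , visits
      where
      visits : ∀ f → Visits (accSet A f) (takePath A a v lapWord followsLap)
      visits f with success f 1 | proj₂ lastFirstVisit f
      ... | suc j , _ , h | le = takePath-visits A a v lapWord followsLap
        (≤-trans (m≤n⇒m≤1+n le) (n≤length-repeat (suc (proj₁ lastFirstVisit)) a v)) h

  open AcceptingTail

  nextTail : AcceptingTail → AcceptingTail
  nextTail t = record
    { run     = λ i → run t (length (lapWord t) + i)
    ; follows = dropPath A a v (lapWord t) (followsLap t)
    ; success = Successful-drop A (length (lapWord t)) (success t)
    }

  laps-next : ∀ t → Laps (start t) (start (nextTail t))
  laps-next t = subst (λ i → Laps (start t) (run t i)) (sym (+-identityʳ _)) (laps t)

  stage : AcceptingTail → ℕ → AcceptingTail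
  stage t zero    = t
  stage t (suc i) = nextTail (stage t i)

  laps-stage : ∀ t {i j} → i < j → Laps (start (stage t i)) (start (stage t j))
  laps-stage t {i} {suc j} i<1+j with m≤n⇒m<n∨m≡n (≤-pred i<1+j)
  ... | inj₂ refl = laps-next (stage t i)
  ... | inj₁ i<j  = Laps-trans (laps-stage t i<j) (laps-next (stage t j))

  -- Among `suc n` successive stages two start in the same state, and the laps between them form the
  -- cycle.
  laps-cycle : (t : AcceptingTail) → Σ (Fin n) λ z → Laps (start t) z × Laps z z
  laps-cycle t with Fin.pigeonhole (n<1+n n) (λ i → start (stage t (toℕ i)))
  ... | i , j , i<j , eq = start (stage t (toℕ j)) , laps-stage t (≤-trans (s≤s z≤n) i<j) ,
        subst (λ y → Laps y (start (stage t (toℕ j)))) eq (laps-stage t i<j)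

  accepts-lasso : Accepts A (ω [] a v) →
                  Σ (Fin n) λ x → Σ (Fin n) λ z → initial A x ≡ true × Laps x z × Laps z z
  accepts-lasso (ρ , (init , follows) , success) with laps-cycle tail
    where tail = record { run = ρ ; follows = follows ; success = success }
  ... | z , xz , zz = ρ 0 , z , init , xz , zz

-- Lassos of different indices that share a cycle state can be spliced: the stem and cycle of `i`,
-- followed by the cycle of `j`, close up there, and the laps of `i` already visit every acceptance
-- set. Hence the cycle states of all `M` lassos are distinct.
fooling : ∀ {m s k M} (B : NGBW m s k) (a : Fin M → Fin m) (v : Fin M → List (Fin m)) →
          (∀ i → Accepts B (ω [] (a i) (v i))) →
          (∀ {i j} → i ≢ j → ∀ b c d →
             ¬ Accepts B (ω (repeat b (a i ∷ v i)) (a i)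
                            ((v i ++ repeat c (a i ∷ v i)) ++ repeat (suc d) (a j ∷ v j)))) →
          M ≤ s
fooling {s = s} {M = M} B a v accepts mixed with M ≤? s
... | yes M≤s = M≤s
... | no  M≰s = contradiction (lasso-accepts init (proj₁ xz) (proj₁ zz ++ᵖ q , visits))
                              (mixed i≢j (suc b) c d)
  where
  lasso : ∀ i → _
  lasso i = accepts-lasso B (a i) (v i) (accepts i)

  collision = Fin.pigeonhole (≰⇒> M≰s) (λ i → proj₁ (proj₂ (lasso i)))
  i = proj₁ collision
  j = proj₁ (proj₂ collision)

  i≢j : i ≢ j
  i≢j = Fin.<⇒≢ (proj₁ (proj₂ (proj₂ collision)))

  init = proj₁ (proj₂ (proj₂ (lasso i)))
  b  = proj₁ (proj₁ (proj₂ (proj₂ (proj₂ (lasso i)))))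
  xz = proj₂ (proj₁ (proj₂ (proj₂ (proj₂ (lasso i)))))
  c  = proj₁ (proj₂ (proj₂ (proj₂ (proj₂ (lasso i)))))
  zz = proj₂ (proj₂ (proj₂ (proj₂ (proj₂ (lasso i)))))

  lapⱼ = subst (λ z → Laps B (a j) (v j) z z) (sym (proj₂ (proj₂ (proj₂ collision))))
               (proj₂ (proj₂ (proj₂ (proj₂ (lasso j)))))
  d = proj₁ lapⱼ
  q = proj₁ (proj₂ lapⱼ)

  visits : ∀ f → Visits (accSet B f) (proj₁ zz ++ᵖ q)
  visits f = visits-++ˡ q (proj₂ zz f)

does-true⇒ : ∀ {P : Set} (d : Dec P) → does d ≡ true → P
does-true⇒ (yes p) _ = p

-- The automaton and its words

-- State aside belongs to no acceptance set, flash to all of them.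
pattern aside  = zero
pattern flash  = suc zero
pattern home q = suc (suc q)

-- The letters `out` and `back` are the two halves of a visit move, `fork` and `merge` those of a
-- drop move.
pattern out   = zero
pattern back  = suc zero
pattern fork  = suc (suc zero)
pattern merge = suc (suc (suc zero))

module _ {N : ℕ} where

  -- This is where the run from `home x` stands between the two letters of `visit q p`. Testing `q`
  -- first makes `visit q q` leave every run at home.
  displaced : Fin N → Fin N → Fin N → Fin (2 + N)
  displaced q p x with x Fin.≟ q | x Fin.≟ p
  ... | yes _ | _     = home p
  ... | no _  | yes _ = aside
  ... | no _  | no _  = home x

  step : Fin 4 → Fin N → Fin N → Fin (2 + N) → Fin (2 + N) → Bool
  step out   q p (home x) t        = does (t Fin.≟ displaced q p x)
  step back  q p aside    t        = does (t Fin.≟ home p)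
  step back  q p (home x) t        with x Fin.≟ p | x Fin.≟ q
  ... | yes _ | _     = does (t Fin.≟ home q)
  ... | no _  | yes _ = false
  ... | no _  | no _  = does (t Fin.≟ home x)
  step fork  x y (home z) (home t) = does (t Fin.≟ z)
  step fork  x y (home z) flash    = does (z Fin.≟ x)
  step merge x y (home z) (home t) = does (t Fin.≟ z)
  step merge x y flash    (home t) = does (t Fin.≟ y)
  step _     _ _ _        _        = false

  out-step : ∀ q p x → step out q p (home x) (displaced q p x) ≡ true
  out-step q p x = dec-true (displaced q p x Fin.≟ displaced q p x) refl

  back-step : ∀ q p x → step back q p (displaced q p x) (home x) ≡ true
  back-step q p x with x Fin.≟ q | x Fin.≟ p
  back-step q p x | no _     | yes refl = dec-true (home p Fin.≟ home p) refl
  back-step q p x | no x≢q   | no x≢p with x Fin.≟ p | x Fin.≟ q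
  ... | yes x≡p | _       = contradiction x≡p x≢p
  ... | no _    | yes x≡q = contradiction x≡q x≢q
  ... | no _    | no _    = dec-true (home x Fin.≟ home x) refl
  back-step q p .q | yes refl | _ with p Fin.≟ p | p Fin.≟ q
  ... | yes _  | _ = dec-true (home q Fin.≟ home q) refl
  ... | no p≢p | _ = contradiction refl p≢p

  back-unique : ∀ q p x t → step back q p (displaced q p x) t ≡ true → t ≡ home x
  back-unique q p x t h with x Fin.≟ q | x Fin.≟ p
  back-unique q p x t h | no _     | yes refl = does-true⇒ (t Fin.≟ home p) h
  back-unique q p x t h | no x≢q   | no x≢p with x Fin.≟ p | x Fin.≟ q
  ... | yes x≡p | _       = contradiction x≡p x≢p
  ... | no _    | yes x≡q = contradiction x≡q x≢q
  ... | no _    | no _    = does-true⇒ (t Fin.≟ home x) h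
  back-unique q p .q t h | yes refl | _ with p Fin.≟ p | p Fin.≟ q
  ... | yes _  | _ = does-true⇒ (t Fin.≟ home q) h
  ... | no p≢p | _ = contradiction refl p≢p

  displaced-self : ∀ q p → displaced q p q ≡ home p
  displaced-self q p with q Fin.≟ q | q Fin.≟ p
  ... | yes _  | _ = refl
  ... | no q≢q | _ = contradiction refl q≢q

  displaced-cases : ∀ q p x → displaced q p x ≡ aside ⊎ displaced q p x ≡ home x
                              ⊎ (x ≡ q × displaced q p x ≡ home p)
  displaced-cases q p x with x Fin.≟ q | x Fin.≟ p
  ... | yes x≡q | _     = inj₂ (inj₂ (x≡q , refl))
  ... | no _    | yes _ = inj₁ refl
  ... | no _    | no _  = inj₂ (inj₁ refl)

  drop-cases : ∀ x y z s t → step fork x y (home z) s ≡ true → step merge x y s t ≡ true →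
               (s ≡ home z × t ≡ home z) ⊎ (z ≡ x × t ≡ home y)
  drop-cases x y z flash    (home t) h h′ =
    inj₂ (does-true⇒ (z Fin.≟ x) h , cong home′ (does-true⇒ (t Fin.≟ y) h′))
    where home′ = λ (q : Fin N) → Fin.suc (Fin.suc q)
  drop-cases x y z (home s) (home t) h h′ with does-true⇒ (s Fin.≟ z) h | does-true⇒ (t Fin.≟ s) h′
  ... | refl | refl = inj₁ (refl , refl)

-- visit q p sends the run at q to p and back while the run at p waits in aside;
-- drop x y adds a run from x to y through flash.
data Macro (N : ℕ) : Set where
  visit : (q p : Fin N) → Macro N
  drop  : (x y : Fin N) → Macro N

module _ {N : ℕ} where

  encode : Fin 4 → Fin N → Fin N → Fin (4 * (N * N))
  encode κ q p = Fin.combine κ (Fin.combine q p)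

  decode : Fin (4 * (N * N)) → Fin 4 × Fin N × Fin N
  decode a = proj₁ r , Fin.remQuot {N} N (proj₂ r)
    where r = Fin.remQuot {4} (N * N) a

  decode-encode : ∀ κ q p → decode (encode κ q p) ≡ (κ , q , p)
  decode-encode κ q p =
    ≡-trans (cong (λ r → proj₁ r , Fin.remQuot {N} N (proj₂ r)) (Fin.remQuot-combine κ (Fin.combine q p)))
            (cong (κ ,_) (Fin.remQuot-combine q p))

  letter₁ letter₂ : Macro N → Fin (4 * (N * N))
  letter₁ (visit q p) = encode out q p
  letter₁ (drop x y)  = encode fork x y
  letter₂ (visit q p) = encode back q p
  letter₂ (drop x y)  = encode merge x y

  flatten : List (Macro N) → List (Fin (4 * (N * N)))
  flatten []       = []
  flatten (μ ∷ us) = letter₁ μ ∷ letter₂ μ ∷ flatten us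

  allMacros : List (Macro N)
  allMacros = cartesianProductWith visit (allFin N) (allFin N) ++ cartesianProductWith drop (allFin N) (allFin N)

  visit∈allMacros : ∀ q p → visit q p ∈ allMacros
  visit∈allMacros q p = ∈-++⁺ˡ (∈-cartesianProductWith⁺ visit (∈-allFin q) (∈-allFin p))

  drop∈allMacros : ∀ x y → drop x y ∈ allMacros
  drop∈allMacros x y = ∈-++⁺ʳ _ (∈-cartesianProductWith⁺ drop (∈-allFin x) (∈-allFin y))

-- Codes: rejected words and accepted mixtures

record Code (N K : ℕ) : Set where
  field
    rank  : Fin N → ℕ
    label : Fin N → Fin K

open Code

Conflict : ∀ {N K} → Code N K → Code N K → Set
Conflict f g = (∃ λ x → ∃ λ y → rank f y < rank f x × rank g x < rank g y)
             ⊎ (∃ λ x → label f x ≢ label g x)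

Independent : ∀ {K N} → (Fin K → Fin N → Bool) → Set
Independent G = ∀ {l l′} → l ≢ l′ → ∀ b b′ → ∃ λ x → G l x ≡ b × G l′ x ≡ b′

-- Through `τ` every acceptance index names a set `G l` and one of its sides. The section `σ`
-- ensures that each side of each set occurs; surplus indices repeat sides.
module Separation
  {N K k : ℕ} (q₀ : Fin N)
  (G : Fin K → Fin N → Bool)
  (independent : Independent G)
  (τ : Fin k → Fin K × Bool) (σ : Fin K × Bool → Fin k) (τ∘σ : ∀ lb → τ (σ lb) ≡ lb)
  where

  member : Fin K × Bool → Fin (2 + N) → Bool
  member (l , b) aside    = false
  member (l , b) flash    = true
  member (l , b) (home x) = does (G l x Bool.≟ b)

  automaton : NGBW (4 * (N * N)) (2 + N) k
  automaton = record
    { initial = λ { (home _) → true ; _ → false }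
    ; trans   = λ s a t → let (κ , q , p) = decode a in step κ q p s t
    ; accSet  = λ j → member (τ j)
    }

  trans-encode : ∀ κ q p s t → trans automaton s (encode κ q p) t ≡ step κ q p s t
  trans-encode κ q p s t = cong (λ (κ , q , p) → step κ q p s t) (decode-encode κ q p)

  -- The far side of the set labelling `x`: the acceptance set that a run returning to `home x`
  -- misses under the word of `f`.
  forbidden : Code N K → Fin N → Fin K × Bool
  forbidden f x = label f x , not (G (label f x) x)

  Obeys : Code N K → Macro N → Set
  Obeys f (visit q p) = G (label f q) p ≡ G (label f q) q
  Obeys f (drop x y)  = rank f y < rank f x

  Obeys? : ∀ f → Decidable (Obeys f)
  Obeys? f (visit q p) = G (label f q) p Bool.≟ G (label f q) q
  Obeys? f (drop x y)  = rank f y <? rank f x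

  -- The first move changes nothing; it makes the word visibly nonempty.
  program : Code N K → List (Macro N)
  program f = visit q₀ q₀ ∷ filter (Obeys? f) allMacros

  program-obeys : ∀ f → All (Obeys f) (program f)
  program-obeys f = refl ∷ All.all-filter (Obeys? f) allMacros

  ∈-program : ∀ f {μ} → μ ∈ allMacros → Obeys f μ → μ ∈ program f
  ∈-program f μ∈ ok = there (∈-filter⁺ (Obeys? f) μ∈ ok)

  a₀ : Fin (4 * (N * N))
  a₀ = letter₁ (visit q₀ q₀)

  v₀ : Code N K → List (Fin (4 * (N * N)))
  v₀ f = letter₂ (visit q₀ q₀) ∷ flatten (filter (Obeys? f) allMacros)

  module _ (f : Code N K) where

    home∉forbidden : ∀ x p → G (label f x) p ≡ G (label f x) x → member (forbidden f x) (home p) ≡ false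
    home∉forbidden x p eq with G (label f x) p | G (label f x) x
    home∉forbidden x p refl | true  | .true  = refl
    home∉forbidden x p refl | false | .false = refl

    -- Between the two letters a run that returns is at `home x`, at a home on the same side as `x`,
    -- or in `aside`, which lies in no acceptance set. A run that does not return passes through
    -- `flash` and, since the drop obeys `f`, falls in rank.
    letters-effect : ∀ μ → Obeys f μ → ∀ x {s t} →
                   trans automaton (home x) (letter₁ μ) s ≡ true →
                   trans automaton s (letter₂ μ) t ≡ true →
                   (t ≡ home x × member (forbidden f x) s ≡ false)
                   ⊎ (∃ λ y → t ≡ home y × rank f y < rank f x)
    letters-effect (visit q p) ok x {s} {t} h h′
      with does-true⇒ (s Fin.≟ displaced q p x) (≡-trans (sym (trans-encode out q p (home x) s)) h)
    ... | refl = inj₁ (back-unique q p x t (≡-trans (sym (trans-encode back q p s t)) h′) , avoids)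
      where
      avoids : member (forbidden f x) (displaced q p x) ≡ false
      avoids with displaced-cases q p x
      ... | inj₁ eq                 rewrite eq = refl
      ... | inj₂ (inj₁ eq)          rewrite eq = home∉forbidden x x refl
      ... | inj₂ (inj₂ (refl , eq)) rewrite eq = home∉forbidden x p ok
    letters-effect (drop y z) ok x {s} {t} h h′
      with drop-cases y z x s t (≡-trans (sym (trans-encode fork y z (home x) s)) h)
                                (≡-trans (sym (trans-encode merge y z s t)) h′)
    ... | inj₁ (refl , refl) = inj₁ (refl , home∉forbidden x x refl)
    ... | inj₂ (refl , refl) = inj₂ (z , refl , ok)

    Tracks : (ℕ → Fin (2 + N)) → List (Macro N) → Set
    Tracks ρ us = Follows automaton ρ (ω (flatten us) a₀ (v₀ f))

    Tracks-unroll : ∀ {ρ} → Tracks ρ [] → Tracks ρ (program f)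
    Tracks-unroll = Follows-cong automaton a₀ (v₀ f) (λ i → sym (ω-unroll a₀ (v₀ f) i))

    -- Lexicographic descent. `stuck` asks acceptance for a position `j` in the forbidden set of
    -- `x`, and `walk` follows the run towards it, unrolling the program when it ends. Each move
    -- either falls in rank, lowering `r`, or returns to `x` and lowers `j`; the visit itself can
    -- occur neither at `x` nor during a returning move.
    stuck  : ∀ r {us ρ x} → All (Obeys f) us → Tracks ρ us → Successful automaton ρ →
             ρ 0 ≡ home x → rank f x < r → ⊥
    walk   : ∀ r j {us ρ x} → All (Obeys f) us → Tracks ρ us → Successful automaton ρ →
             ρ 0 ≡ home x → rank f x < suc r → member (forbidden f x) (ρ j) ≡ true → ⊥
    walk-∷ : ∀ r j {μ us ρ x} → All (Obeys f) (μ ∷ us) → Tracks ρ (μ ∷ us) → Successful automaton ρ →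
             ρ 0 ≡ home x → rank f x < suc r → member (forbidden f x) (ρ j) ≡ true → ⊥

    stuck (suc r) {ρ = ρ} {x} ok tr succ ρ0 x<r with succ (σ (forbidden f x)) 0
    ... | j , _ , h = walk r j ok tr succ ρ0 x<r (subst (λ lb → member lb (ρ j) ≡ true) (τ∘σ _) h)

    walk r j {[]}    _  tr = walk-∷ r j (program-obeys f) (Tracks-unroll tr)
    walk r j {_ ∷ _} ok tr = walk-∷ r j ok tr

    walk-∷ r zero {x = x} _ _ _ ρ0 _ h =
      contradiction (≡-trans (sym h) (≡-trans (cong (member (forbidden f x)) ρ0) (home∉forbidden x x refl))) λ ()
    walk-∷ r (suc j) {μ} {us} {ρ} {x} (ok ∷ oks) tr succ ρ0 x<r h
      with letters-effect μ ok x (subst (λ s → trans automaton s (letter₁ μ) (ρ 1) ≡ true) ρ0 (tr 0)) (tr 1)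
    ... | inj₂ (y , ρ2 , y<x) =
      stuck r oks (λ i → tr (2 + i)) (Successful-drop automaton {ρ} 2 succ) ρ2 (≤-trans y<x (≤-pred x<r))
    ... | inj₁ (ρ2 , ρ1∉) = continue j h
      where
      continue : ∀ j → member (forbidden f x) (ρ (suc j)) ≡ true → ⊥
      continue zero    h with () ← ≡-trans (sym h) ρ1∉
      continue (suc j) h =
        walk r j oks (λ i → tr (2 + i)) (Successful-drop automaton {ρ} 2 succ) ρ2 x<r h

    rejects : ¬ Accepts automaton (ω [] a₀ (v₀ f))
    rejects (ρ , (init , follows) , succ) with ρ 0 in ρ0
    ... | home x = stuck (suc (rank f x)) [] follows succ ρ0 ≤-refl

  -- This serves the words of all codes alike, so one home state can be kept throughout a mixture of
  -- two words.
  stay-edges : ∀ μ x → Σ (Fin (2 + N)) λ s → trans automaton (home x) (letter₁ μ) s ≡ true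
                                            × trans automaton s (letter₂ μ) (home x) ≡ true
  stay-edges (visit q p) x = displaced q p x ,
    ≡-trans (trans-encode out q p _ _) (out-step q p x) ,
    ≡-trans (trans-encode back q p _ _) (back-step q p x)
  stay-edges (drop y z) x = home x ,
    ≡-trans (trans-encode fork y z _ _) (dec-true (x Fin.≟ x) refl) ,
    ≡-trans (trans-encode merge y z _ _) (dec-true (x Fin.≟ x) refl)

  stay : ∀ us x → Path automaton (home x) (flatten us) (home x)
  stay []       x = []
  stay (μ ∷ us) x = proj₁ (proj₂ (stay-edges μ x)) ∷ proj₂ (proj₂ (stay-edges μ x)) ∷ stay us x

  stay-visits : ∀ {F us x p} → visit x p ∈ us → F (home p) ≡ true → Visits F (stay us x)
  stay-visits {F} {x = x} {p} (here refl) h = here (subst (λ s → F s ≡ true) (sym (displaced-self x p)) h)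
  stay-visits (there μ∈)  h = there (there (stay-visits μ∈ h))

  -- The run waits at `x` until the drop, passes `flash`, which lies in all acceptance sets, and
  -- then waits at `y`.
  fall : ∀ {us x y} → drop x y ∈ us → Lap automaton (home x) (flatten us) (home y)
  fall {_ ∷ us} {x} {y} (here refl) =
    ≡-trans (trans-encode fork x y _ flash) (dec-true (x Fin.≟ x) refl) ∷
    ≡-trans (trans-encode merge x y flash _) (dec-true (y Fin.≟ y) refl) ∷ stay us y ,
    λ j → here refl
  fall {μ ∷ us} {x} (there μ∈) with fall μ∈
  ... | p , visits =
    proj₁ (proj₂ (stay-edges μ x)) ∷ proj₂ (proj₂ (stay-edges μ x)) ∷ p , λ j → there (there (visits j))

  -- If `τ j` concerns the label of `x`, it is the side of `x` itself, met by `visit x x`. Otherwise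
  -- independence supplies a home on the side of `x` in the labelling set and on side `b` of the
  -- other set.
  sweep-visits : ∀ f x j → τ j ≢ forbidden f x → Visits (accSet automaton j) (stay (program f) x)
  sweep-visits f x j τj≢ with τ j
  ... | l , b with label f x Fin.≟ l
  ...   | yes refl = stay-visits {F = member (l , b)} (∈-program f (visit∈allMacros x x) refl) (dec-true (G l x Bool.≟ b)
                       (≡-trans (sym (Bool.not-involutive _)) (sym (Bool.¬-not λ b≡ → τj≢ (cong (l ,_) b≡)))))
  ...   | no l≢ with independent l≢ (G (label f x) x) b
  ...     | p , p∈ , p∈′ = stay-visits {F = member (l , b)} (∈-program f (visit∈allMacros x p) p∈) (dec-true (G l p Bool.≟ b) p∈′)

  stay-repeat : ∀ f b x → Path automaton (home x) (repeat b (flatten (program f))) (home x)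
  stay-repeat f zero    x = []
  stay-repeat f (suc b) x = stay (program f) x ++ᵖ stay-repeat f b x

  mixed-accepts : ∀ {f g} → Conflict f g → ∀ b c d →
    Accepts automaton (ω (repeat b (a₀ ∷ v₀ f)) a₀
      ((v₀ f ++ repeat c (a₀ ∷ v₀ f)) ++ repeat (suc d) (a₀ ∷ v₀ g)))
  -- The fall under `f` visits every acceptance set; the opposite fall under `g` closes the cycle.
  mixed-accepts {f} {g} (inj₁ (x , y , y<x , x<y)) b c d
    with fall (∈-program f (drop∈allMacros x y) y<x) | fall (∈-program g (drop∈allMacros y x) x<y)
  ... | p , visits | q , _ = lasso-accepts refl (stay-repeat f b x)
        ( (p ++ᵖ stay-repeat f c y) ++ᵖ (q ++ᵖ stay-repeat g d x)
        , λ j → visits-++ˡ (q ++ᵖ stay-repeat g d x) (visits-++ˡ (stay-repeat f c y) (visits j)))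
  mixed-accepts {f} {g} (inj₂ (x , f≢g)) b c d = lasso-accepts refl (stay-repeat f b x)
        ( stay-repeat f (suc c) x ++ᵖ stay-repeat g (suc d) x , visits)
    where
    visits : ∀ j → Visits (accSet automaton j) (stay-repeat f (suc c) x ++ᵖ stay-repeat g (suc d) x)
    -- The labels of `x` differ, so the set of index `j` differs from at least one of them, and the
    -- sweep under that code meets it.
    visits j with label f x Fin.≟ proj₁ (τ j)
    ... | no ≢τ = visits-++ˡ (stay-repeat g (suc d) x)
                    (visits-++ˡ (stay-repeat f c x) (sweep-visits f x j (λ eq → ≢τ (sym (cong proj₁ eq)))))
    ... | yes ≡τ = visits-++ʳ (stay-repeat f (suc c) x)
                    (visits-++ˡ (stay-repeat g d x)
                      (sweep-visits g x j (λ eq → f≢g (≡-trans ≡τ (cong proj₁ eq)))))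

  complement-large : ∀ {M s k′} (code : Fin M → Code N K) → (∀ {i j} → i ≢ j → Conflict (code i) (code j)) →
                     (B : NGBW (4 * (N * N)) s k′) → AcceptsComplementOf B automaton → M ≤ s
  complement-large code conflict B complement =
    fooling B (λ _ → a₀) (v₀ ∘ code) (λ i → proj₂ (complement _) (rejects (code i)))
      (λ i≢j b c d acc → proj₁ (complement _) acc (mixed-accepts (conflict i≢j) b c d))

-- Counting codes

punchIn-mono-< : ∀ {n} c (x y : Fin n) → x Fin.< y → Fin.punchIn c x Fin.< Fin.punchIn c y
punchIn-mono-< c x y x<y = ≰⇒> λ le → <⇒≱ x<y (Fin.punchIn-cancel-≤ c y x le)

i≤j⇒i<punchIn : ∀ {n} (i : Fin (suc n)) (j : Fin n) → toℕ i ≤ toℕ j → i Fin.< Fin.punchIn i j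
i≤j⇒i<punchIn zero    j       _         = s≤s z≤n
i≤j⇒i<punchIn (suc i) (suc j) (s≤s i≤j) = s≤s (i≤j⇒i<punchIn i j i≤j)

j<i⇒punchIn<i : ∀ {n} (i : Fin (suc n)) (j : Fin n) → toℕ j < toℕ i → Fin.punchIn i j Fin.< i
j<i⇒punchIn<i (suc i) zero    _         = s≤s z≤n
j<i⇒punchIn<i (suc i) (suc j) (s≤s j<i) = s≤s (j<i⇒punchIn<i i j j<i)

-- Lehmer-style numbering: the digit `c` is the rank of element 0, and the remaining digits order
-- the other elements.
perm : ∀ N → Fin (N !) → Permutation′ N
perm⁺ : ∀ N → Fin (suc N) × Fin (N !) → Permutation′ (suc N)
perm zero    _ = Permutation.id
perm (suc N) i = perm⁺ N (Fin.remQuot {suc N} (N !) i)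
perm⁺ N (c , r) = insert zero c (perm N r)

Inverted : ∀ {N} → Permutation′ N → Permutation′ N → Set
Inverted π ψ = ∃ λ x → ∃ λ y → π ⟨$⟩ʳ y Fin.< π ⟨$⟩ʳ x × ψ ⟨$⟩ʳ x Fin.< ψ ⟨$⟩ʳ y

Inverted-sym : ∀ {N} {π ψ : Permutation′ N} → Inverted π ψ → Inverted ψ π
Inverted-sym (x , y , π< , ψ<) = y , x , ψ< , π<

-- Inserting a new element keeps the relative order of the old ones, so inversions between smaller
-- orders survive.
insert-mono : ∀ {N} c (π : Permutation′ N) x y → π ⟨$⟩ʳ x Fin.< π ⟨$⟩ʳ y →
              insert zero c π ⟨$⟩ʳ suc x Fin.< insert zero c π ⟨$⟩ʳ suc y
insert-mono c π x y lt = subst₂ Fin._<_ (sym (insert-punchIn zero c π x)) (sym (insert-punchIn zero c π y))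
                           (punchIn-mono-< c _ _ lt)

-- The element of rank c in π separates the two positions c < d of the new element 0.
insert-inverted : ∀ {N} {c d} (π : Permutation′ N) → c Fin.< d → Inverted (insert zero c π) (insert zero d π)
insert-inverted {N} {c} {d} π c<d = suc x , zero ,
  subst (c Fin.<_) (sym (≡-trans (insert-punchIn zero c π x) (cong (Fin.punchIn c) (inverseʳ π))))
    (i≤j⇒i<punchIn c c′ (≤-reflexive (sym toℕ-c′))) ,
  subst (Fin._< d) (sym (≡-trans (insert-punchIn zero d π x) (cong (Fin.punchIn d) (inverseʳ π))))
    (j<i⇒punchIn<i d c′ (subst (_< toℕ d) (sym toℕ-c′) c<d))
  where
  c<N : toℕ c < N
  c<N = ≤-trans c<d (≤-pred (Fin.toℕ<n d))
  c′ = Fin.fromℕ< c<N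
  toℕ-c′ : toℕ c′ ≡ toℕ c
  toℕ-c′ = Fin.toℕ-fromℕ< c<N
  x = π ⟨$⟩ˡ c′

remQuot-injective : ∀ {m} n {i j : Fin (m * n)} → Fin.remQuot {m} n i ≡ Fin.remQuot n j → i ≡ j
remQuot-injective {m} n {i} {j} eq =
  ≡-trans (sym (Fin.combine-remQuot {m} n i))
    (≡-trans (cong (λ r → Fin.combine (proj₁ r) (proj₂ r)) eq) (Fin.combine-remQuot {m} n j))

-- If the orders of the old elements differ, their inversion lifts; if they agree, the ranks of the
-- new element differ and `insert-inverted` applies.
perm-inverted  : ∀ N {i j} → i ≢ j → Inverted (perm N i) (perm N j)
perm⁺-inverted : ∀ N {i j} → i ≢ j → Inverted (perm⁺ N i) (perm⁺ N j)
perm-inverted zero    {zero} {zero} i≢j = contradiction refl i≢j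
perm-inverted (suc N) i≢j = perm⁺-inverted N (i≢j ∘ remQuot-injective {suc N} (N !))
perm⁺-inverted N {c , r} {d , r′} i≢j with r Fin.≟ r′ | <-cmp (toℕ c) (toℕ d)
... | yes refl | tri< c<d _ _ = insert-inverted (perm N r) c<d
... | yes refl | tri> _ _ d<c = Inverted-sym {π = perm⁺ N (d , r)} {ψ = perm⁺ N (c , r)}
                                  (insert-inverted (perm N r) d<c)
... | yes refl | tri≈ _ c≡d _ = contradiction (cong (_, r) (Fin.toℕ-injective c≡d)) i≢j
... | no r≢r′  | _ with perm-inverted N r≢r′
...   | x , y , lt , lt′ = suc x , suc y , insert-mono c (perm N r) y x lt , insert-mono d (perm N r′) x y lt′

funToFin-cong : ∀ {m n} {f g : Fin m → Fin n} → f ≗ g → Fin.funToFin f ≡ Fin.funToFin g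
funToFin-cong {zero}  eq = refl
funToFin-cong {suc m} eq = cong₂ Fin.combine (eq zero) (funToFin-cong (eq ∘ suc))

finToFun-separates : ∀ {m n} {i j : Fin (n ^ m)} → i ≢ j → ∃ λ x → Fin.finToFun {n} {m} i x ≢ Fin.finToFun j x
finToFun-separates {m} {n} {i} {j} i≢j = Fin.¬∀⟶∃¬ m _ (λ x → Fin.finToFun {n} {m} i x Fin.≟ Fin.finToFun j x) λ same →
  i≢j (≡-trans (sym (Fin.funToFin-finToFin {m} {n} i)) (≡-trans (funToFin-cong same) (Fin.funToFin-finToFin {m} {n} j)))

code : ∀ {N K} → Fin (N ! * K ^ N) → Code N K
code {N} {K} i = record
  { rank  = λ x → toℕ (perm N (proj₁ r) ⟨$⟩ʳ x)
  ; label = Fin.finToFun (proj₂ r)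
  }
  where r = Fin.remQuot {N !} (K ^ N) i

code-conflict : ∀ {N K} {i j : Fin (N ! * K ^ N)} → i ≢ j → Conflict (code i) (code j)
code-conflict {N} {K} {i} {j} i≢j with proj₁ (Fin.remQuot {N !} (K ^ N) i) Fin.≟ proj₁ (Fin.remQuot {N !} (K ^ N) j)
... | no ≢₁ = inj₁ (perm-inverted N ≢₁)
... | yes ≡₁ = inj₂ (finToFun-separates {N} {K} λ ≡₂ → i≢j (remQuot-injective {N !} (K ^ N) (cong₂ _,_ ≡₁ ≡₂)))

-- Qualitatively independent sets

subsets : ∀ P → ℕ → List (Subset P)
subsets P       zero    = Subset.⊥ ∷ []
subsets zero    (suc j) = []
subsets (suc P) (suc j) = List.map (inside ∷_) (subsets P j) ++ List.map (outside ∷_) (subsets P (suc j))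

length-subsets : ∀ P j → length (subsets P j) ≡ P C j
length-subsets P       zero    = refl
length-subsets zero    (suc j) = refl
length-subsets (suc P) (suc j) = begin
  length (subsets (suc P) (suc j))
    ≡⟨ List.length-++ (List.map (inside ∷_) (subsets P j)) ⟩
  length (List.map (inside ∷_) (subsets P j)) + length (List.map (outside ∷_) (subsets P (suc j)))
    ≡⟨ cong₂ _+_ (List.length-map _ (subsets P j)) (List.length-map _ (subsets P (suc j))) ⟩
  length (subsets P j) + length (subsets P (suc j))
    ≡⟨ cong₂ _+_ (length-subsets P j) (length-subsets P (suc j)) ⟩
  P C j + P C suc j
    ≡⟨ nCk+nC[k+1]≡[n+1]C[k+1] P j ⟩
  suc P C suc j ∎
  where open ≡-Reasoning

∣subsets∣ : ∀ P j → All (λ A → ∣ A ∣ ≡ j) (subsets P j)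
∣subsets∣ P       zero    = ∣⊥∣≡0 P ∷ []
∣subsets∣ zero    (suc j) = []
∣subsets∣ (suc P) (suc j) = All.++⁺ (All.map⁺ (All.map (cong suc) (∣subsets∣ P j)))
                                    (All.map⁺ (∣subsets∣ P (suc j)))

subsets-unique : ∀ P j → Unique (subsets P j)
subsets-unique P       zero    = [] ∷ []
subsets-unique zero    (suc j) = []
subsets-unique (suc P) (suc j) = Unique.++⁺ (Unique.map⁺ ∷-injectiveʳ (subsets-unique P j))
                                            (Unique.map⁺ ∷-injectiveʳ (subsets-unique P (suc j)))
                                            disjoint
  where
  disjoint : ∀ {A} → ¬ (A ∈ List.map (inside ∷_) (subsets P j) × A ∈ List.map (outside ∷_) (subsets P (suc j)))
  disjoint (∈i , ∈o) with ∈-map⁻ (inside ∷_) ∈i | ∈-map⁻ (outside ∷_) ∈o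
  ... | _ , _ , refl | _ , _ , ()

lookup-injective : ∀ {X : Set} {xs : List X} → Unique xs → ∀ i j → List.lookup xs i ≡ List.lookup xs j → i ≡ j
lookup-injective (x∉ ∷ u) zero    zero    _  = refl
lookup-injective (x∉ ∷ u) zero    (suc j) eq = contradiction eq (All.lookup x∉ (∈-lookup j))
lookup-injective (x∉ ∷ u) (suc i) zero    eq = contradiction (sym eq) (All.lookup x∉ (∈-lookup i))
lookup-injective (x∉ ∷ u) (suc i) (suc j) eq = cong suc (lookup-injective u i j eq)

-- A subset of `B` that is at least as large as `B` equals `B`.
equal-or-difference : ∀ {P} (A B : Subset P) → ∣ B ∣ ≤ ∣ A ∣ →
                      A ≡ B ⊎ ∃ λ x → lookup A x ≡ true × lookup B x ≡ false
equal-or-difference []            []            _ = inj₁ refl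
equal-or-difference (true  ∷ A) (false ∷ B) _ = inj₂ (zero , refl , refl)
equal-or-difference (true  ∷ A) (true  ∷ B) (s≤s le) with equal-or-difference A B le
... | inj₁ eq          = inj₁ (cong (true ∷_) eq)
... | inj₂ (x , a , b) = inj₂ (suc x , a , b)
equal-or-difference (false ∷ A) (false ∷ B) le with equal-or-difference A B le
... | inj₁ eq          = inj₁ (cong (false ∷_) eq)
... | inj₂ (x , a , b) = inj₂ (suc x , a , b)
equal-or-difference (false ∷ A) (true  ∷ B) le with equal-or-difference A B (≤-trans (n≤1+n _) le)
... | inj₁ refl        = contradiction le (<-irrefl refl)
... | inj₂ (x , a , b) = inj₂ (suc x , a , b)

-- The union has at most `∣ A ∣ + ∣ B ∣` elements, too few to cover everything.
common-outside : ∀ {P} (A B : Subset P) → ∣ A ∣ + ∣ B ∣ < P → ∃ λ x → lookup A x ≡ false × lookup B x ≡ false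
common-outside []            []            ()
common-outside (false ∷ A) (false ∷ B) _ = zero , refl , refl
common-outside (true ∷ A)  (false ∷ B) (s≤s lt) with common-outside A B lt
... | x , a , b = suc x , a , b
common-outside (true ∷ A)  (true ∷ B)  (s≤s lt) with common-outside A B (≤-trans (s≤s (+-monoʳ-≤ ∣ A ∣ (n≤1+n _))) lt)
... | x , a , b = suc x , a , b
common-outside {suc P} (false ∷ A) (true ∷ B) lt
  with common-outside A B (≤-pred (subst (_< suc P) (+-suc ∣ A ∣ ∣ B ∣) lt))
... | x , a , b = suc x , a , b

-- All sets contain 0 and have j + 1 elements; for maximal j this is the extremal family of
-- qualitatively independent sets (Kleitman–Spencer, Katona).
independent-family : ∀ P j → j + j < P → ∀ K → K ≤ P C j →
                     Σ (Fin K → Fin (suc P) → Bool) Independent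
independent-family P j 2j<P K K≤ = (λ l x → lookup (inside ∷ set l) x) , independent
  where
  index : Fin K → Fin (length (subsets P j))
  index l = Fin.inject≤ l (subst (K ≤_) (sym (length-subsets P j)) K≤)

  set : Fin K → Subset P
  set l = List.lookup (subsets P j) (index l)

  ∣set∣ : ∀ l → ∣ set l ∣ ≡ j
  ∣set∣ l = All.lookup (∣subsets∣ P j) (∈-lookup (index l))

  difference : ∀ {l l′} → l ≢ l′ → ∃ λ x → lookup (set l) x ≡ true × lookup (set l′) x ≡ false
  difference {l} {l′} l≢l′ with equal-or-difference (set l) (set l′) (≤-reflexive (≡-trans (∣set∣ l′) (sym (∣set∣ l))))
  ... | inj₂ d  = d
  ... | inj₁ eq = contradiction
    (Fin.inject≤-injective _ _ l l′ (lookup-injective (subsets-unique P j) (index l) (index l′) eq)) l≢l′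

  independent : Independent (λ l x → lookup (inside ∷ set l) x)
  -- The added element 0 lies in all sets. The mixed cases use that distinct sets have equal size,
  -- the last one that two sets together have fewer than `P` elements.
  independent l≢l′ true  true  = zero , refl , refl
  independent l≢l′ true  false with difference l≢l′
  ... | x , a , b = suc x , a , b
  independent l≢l′ false true  with difference (l≢l′ ∘ sym)
  ... | x , a , b = suc x , b , a
  independent {l} {l′} l≢l′ false false
    with common-outside (set l) (set l′) (subst (_< P) (sym (cong₂ _+_ (∣set∣ l) (∣set∣ l′))) 2j<P)
  ... | x , a , b = suc x , a , b

-- Arithmetic

C-absorb : ∀ m j → suc j * (suc m C suc j) ≡ suc m * (m C j)
C-absorb m       zero    = ≡-trans (*-identityˡ _) (≡-trans (nC1≡n (suc m)) (sym (*-identityʳ _)))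
C-absorb zero    (suc j) = *-zeroʳ j
C-absorb (suc m) (suc j) = begin
  suc (suc j) * (suc (suc m) C suc (suc j))
    ≡⟨ cong (suc (suc j) *_) (nCk+nC[k+1]≡[n+1]C[k+1] (suc m) (suc j)) ⟨
  suc (suc j) * (suc m C suc j + suc m C suc (suc j))
    ≡⟨ *-distribˡ-+ (suc (suc j)) (suc m C suc j) _ ⟩
  (suc m C suc j + suc j * (suc m C suc j)) + suc (suc j) * (suc m C suc (suc j))
    ≡⟨ cong₂ (λ x y → (suc m C suc j + x) + y) (C-absorb m j) (C-absorb m (suc j)) ⟩
  (suc m C suc j + suc m * (m C j)) + suc m * (m C suc j)
    ≡⟨ +-assoc (suc m C suc j) _ _ ⟩
  suc m C suc j + (suc m * (m C j) + suc m * (m C suc j))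
    ≡⟨ cong (suc m C suc j +_) (*-distribˡ-+ (suc m) (m C j) _) ⟨
  suc m C suc j + suc m * (m C j + m C suc j)
    ≡⟨ cong (λ x → suc m C suc j + suc m * x) (nCk+nC[k+1]≡[n+1]C[k+1] m j) ⟩
  suc (suc m) * (suc m C suc j) ∎
  where open ≡-Reasoning

C-ratio : ∀ c m j → suc m ≤ c * suc j → suc m C suc j ≤ c * (m C j)
C-ratio c m j le = *-cancelˡ-≤ (suc j) (begin
  suc j * (suc m C suc j) ≡⟨ C-absorb m j ⟩
  suc m * (m C j)         ≤⟨ *-monoˡ-≤ (m C j) le ⟩
  c * suc j * (m C j)     ≡⟨ cong (_* (m C j)) (*-comm c (suc j)) ⟩
  suc j * c * (m C j)     ≡⟨ *-assoc (suc j) c _ ⟩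
  suc j * (c * (m C j))   ∎)
  where open ≤-Reasoning

C≤2^ : ∀ m j → m C j ≤ 2 ^ m
C≤2^ m       zero    = m^n>0 2 m
C≤2^ zero    (suc j) = z≤n
C≤2^ (suc m) (suc j) = begin
  suc m C suc j       ≡⟨ nCk+nC[k+1]≡[n+1]C[k+1] m j ⟨
  m C j + m C suc j   ≤⟨ +-mono-≤ (C≤2^ m j) (C≤2^ m (suc j)) ⟩
  2 ^ m + 2 ^ m       ≡⟨ cong (2 ^ m +_) (+-identityʳ _) ⟨
  2 ^ suc m           ∎
  where open ≤-Reasoning

n≤1+2[n/2] : ∀ n → n ≤ 1 + n / 2 * 2
n≤1+2[n/2] n = begin
  n                   ≡⟨ m≡m%n+[m/n]*n n 2 ⟩
  n % 2 + n / 2 * 2   ≤⟨ +-monoˡ-≤ _ (≤-pred (m%n<n n 2)) ⟩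
  1 + n / 2 * 2       ∎
  where open ≤-Reasoning

-- The mean value estimate for powers: the increment is at most the derivative at the larger point.
^-step : ∀ n m → suc n ^ suc m ≤ n ^ suc m + suc m * suc n ^ m
^-step n zero    = ≤-reflexive (ring n)
  where
  ring : ∀ n → suc n * 1 ≡ n * 1 + (1 + 0)
  ring = solve-∀
^-step n (suc m) = begin
  suc n * suc n ^ suc m
    ≤⟨ *-monoʳ-≤ (suc n) (^-step n m) ⟩
  suc n * (n ^ suc m + suc m * suc n ^ m)
    ≡⟨ ring n (n ^ suc m) (suc m) (suc n ^ m) ⟩
  n ^ suc m + (n * n ^ suc m + suc m * suc n ^ suc m)
    ≤⟨ +-monoˡ-≤ _ (^-monoˡ-≤ (suc m) (n≤1+n n)) ⟩
  suc n ^ suc m + (n * n ^ suc m + suc m * suc n ^ suc m)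
    ≡⟨ ring′ (suc n ^ suc m) (n ^ suc (suc m)) (suc m * suc n ^ suc m) ⟩
  n ^ suc (suc m) + suc (suc m) * suc n ^ suc m ∎
  where
  open ≤-Reasoning
  ring : ∀ n x m y → suc n * (x + m * y) ≡ x + (n * x + m * (suc n * y))
  ring = solve-∀
  ring′ : ∀ x y z → x + (y + z) ≡ y + (x + z)
  ring′ = solve-∀

-- A weak Stirling bound. By `^-step` the quotient of `n ^ m` by `m !` satisfies a Pascal-like
-- inequality, which the doubling of `2 ^ (n + m)` dominates. For `m = n` it replaces `n ^ n` by
-- `n !` at a cost of `4 ^ n`.
^≤2^*! : ∀ n m → n ^ m ≤ 2 ^ (n + m) * m !
^≤2^*! n       zero    = ≤-trans (m^n>0 2 (n + 0)) (m≤m*n _ 1)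
^≤2^*! zero    (suc m) = z≤n
^≤2^*! (suc n) (suc m) = begin
  suc n ^ suc m
    ≤⟨ ^-step n m ⟩
  n ^ suc m + suc m * suc n ^ m
    ≤⟨ +-mono-≤ (^≤2^*! n (suc m)) (*-monoʳ-≤ (suc m) (^≤2^*! (suc n) m)) ⟩
  2 ^ (n + suc m) * suc m ! + suc m * (2 ^ (suc n + m) * m !)
    ≡⟨ cong (λ t → 2 ^ t * suc m ! + suc m * (2 ^ (suc n + m) * m !)) (+-suc n m) ⟩
  2 ^ (suc n + m) * (suc m * m !) + suc m * (2 ^ (suc n + m) * m !)
    ≡⟨ ring (2 ^ (suc n + m)) (suc m) (m !) ⟩
  2 * 2 ^ (suc n + m) * (suc m * m !)
    ≡⟨ cong (λ t → 2 ^ t * suc m !) (+-suc (suc n) m) ⟨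
  2 ^ (suc n + suc m) * suc m ! ∎
  where
  open ≤-Reasoning
  ring : ∀ x y z → x * (y * z) + y * (x * z) ≡ 2 * x * (y * z)
  ring = solve-∀

n≤2^n : ∀ n → n ≤ 2 ^ n
n≤2^n zero    = z≤n
n≤2^n (suc n) = +-mono-≤ (m^n>0 2 n) (≤-trans (n≤2^n n) (m≤m+n _ 0))

^-distribʳ-* : ∀ m n o → (m * n) ^ o ≡ m ^ o * n ^ o
^-distribʳ-* m n zero    = refl
^-distribʳ-* m n (suc o) = ≡-trans (cong (m * n *_) (^-distribʳ-* m n o)) (ring m n (m ^ o) (n ^ o))
  where
  ring : ∀ m n x y → m * n * (x * y) ≡ m * x * (n * y)
  ring = solve-∀

-- 768 = 2^6 · 12: n^n costs 2^4n, the two surplus factors k cost 2^2n.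
count-bound : ∀ n N k K s → n ≡ 2 + N → k ≤ 12 * K → k ≤ 2 ^ n → N ! * K ^ N ≤ s →
              (1 * n * k) ^ n ≤ 768 ^ n * s
count-bound n N k K s n≡2+N k≤12K k≤2^n ≤s = begin
  (1 * n * k) ^ n
    ≡⟨ cong (λ t → (t * k) ^ n) (*-identityˡ n) ⟩
  (n * k) ^ n
    ≡⟨ ^-distribʳ-* n k n ⟩
  n ^ n * k ^ n
    ≤⟨ *-mono-≤ n^n≤ k^n≤ ⟩
  (u * u * (u * (u * N !))) * (u * (u * (t * K ^ N)))
    ≡⟨ ring u t (N !) (K ^ N) ⟩
  u * (u * (u * (u * (u * (u * t))))) * (N ! * K ^ N)
    ≡⟨ cong (_* (N ! * K ^ N)) 768^n ⟨
  768 ^ n * (N ! * K ^ N)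
    ≤⟨ *-monoʳ-≤ (768 ^ n) ≤s ⟩
  768 ^ n * s ∎
  where
  open ≤-Reasoning
  u = 2 ^ n
  t = 12 ^ n

  2+N≤2^n : 2 + N ≤ u
  2+N≤2^n = subst (_≤ u) n≡2+N (n≤2^n n)

  n! : n ! ≤ u * (u * N !)
  n! = subst (λ i → i ! ≤ u * (u * N !)) (sym n≡2+N)
    (*-mono-≤ 2+N≤2^n (*-monoˡ-≤ (N !) (≤-trans (n≤1+n (suc N)) 2+N≤2^n)))

  n^n≤ : n ^ n ≤ u * u * (u * (u * N !))
  n^n≤ = ≤-trans (^≤2^*! n n) (*-mono-≤ (≤-reflexive (^-distribˡ-+-* 2 n n)) n!)

  k^N≤ : k ^ N ≤ t * K ^ N
  k^N≤ = ≤-trans (^-monoˡ-≤ N k≤12K) (≤-trans (≤-reflexive (^-distribʳ-* 12 K N))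
    (*-monoˡ-≤ (K ^ N) (^-monoʳ-≤ 12 (≤-trans (m≤n+m N 2) (≤-reflexive (sym n≡2+N))))))

  k^n≤ : k ^ n ≤ u * (u * (t * K ^ N))
  k^n≤ = subst (λ i → k ^ i ≤ u * (u * (t * K ^ N))) (sym n≡2+N)
    (*-mono-≤ k≤2^n (*-mono-≤ k≤2^n k^N≤))

  768^n : 768 ^ n ≡ u * (u * (u * (u * (u * (u * t)))))
  768^n = begin-equality
    768 ^ n                            ≡⟨ ^-distribʳ-* 64 12 n ⟩
    64 ^ n * t                         ≡⟨ cong (_* t) (^-distribʳ-* 8 8 n) ⟩
    8 ^ n * 8 ^ n * t                  ≡⟨ cong (λ e → e * e * t) (^-distribʳ-* 2 4 n) ⟩
    u * 4 ^ n * (u * 4 ^ n) * t        ≡⟨ cong (λ e → u * e * (u * e) * t) (^-distribʳ-* 2 2 n) ⟩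
    u * (u * u) * (u * (u * u)) * t    ≡⟨ ring₂ u t ⟩
    u * (u * (u * (u * (u * (u * t))))) ∎
    where
    ring₂ : ∀ u t → u * (u * u) * (u * (u * u)) * t ≡ u * (u * (u * (u * (u * (u * t)))))
    ring₂ = solve-∀

  ring : ∀ u t x y → (u * u * (u * (u * x))) * (u * (u * (t * y))) ≡ u * (u * (u * (u * (u * (u * t))))) * (x * y)
  ring = solve-∀

-- Fitting the parameters to n and k

Fin-retract : ∀ {m n} → Fin m → m ≤ n → Σ (Fin n → Fin m) λ r → Σ (Fin m → Fin n) λ s → ∀ i → r (s i) ≡ i
Fin-retract {m} {n} default m≤n = r , s , r∘s
  where
  r : Fin n → Fin m
  r j with toℕ j <? m
  ... | yes j<m = Fin.fromℕ< j<m
  ... | no  _   = default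

  s : Fin m → Fin n
  s i = Fin.inject≤ i m≤n

  r∘s : ∀ i → r (s i) ≡ i
  r∘s i with toℕ (s i) <? m
  ... | yes lt = Fin.toℕ-injective (≡-trans (Fin.toℕ-fromℕ< lt) (Fin.toℕ-inject≤ i m≤n))
  ... | no ≮   = contradiction (subst (_< m) (sym (Fin.toℕ-inject≤ i m≤n)) (Fin.toℕ<n i)) ≮

-- Two indices per set carry its two sides. Indices beyond `K * 2` all repeat one side, so the
-- automaton has index exactly `k`.
signed-retract : ∀ {K k} → 0 < K → K * 2 ≤ k →
                 Σ (Fin k → Fin K × Bool) λ τ → Σ (Fin K × Bool → Fin k) λ σ → ∀ lb → τ (σ lb) ≡ lb
signed-retract {suc K} {k} _ 2K≤k with Fin-retract {suc K * 2} zero 2K≤k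
... | r , s , r∘s = τ , σ , τ∘σ
  where
  open Inverse Fin.2↔Bool using (to; from; strictlyInverseˡ)

  signed : Fin (suc K * 2) → Fin (suc K) × Bool
  signed i = proj₁ (Fin.remQuot {suc K} 2 i) , to (proj₂ (Fin.remQuot {suc K} 2 i))

  τ : Fin k → Fin (suc K) × Bool
  τ j = signed (r j)

  σ : Fin (suc K) × Bool → Fin k
  σ (l , b) = s (Fin.combine l (from b))

  τ∘σ : ∀ lb → τ (σ lb) ≡ lb
  τ∘σ (l , b) = begin
    signed (r (s (Fin.combine l (from b)))) ≡⟨ cong signed (r∘s _) ⟩
    signed (Fin.combine l (from b))         ≡⟨ cong (λ e → proj₁ e , to (proj₂ e)) (Fin.remQuot-combine l (from b)) ⟩
    l , to (from b)                         ≡⟨ cong (l ,_) (strictlyInverseˡ b) ⟩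
    l , b                                   ∎
    where open ≡-Reasoning

-- The constant is 1/768, cleared of denominators; the factor 1 is its numerator.
ComplementBound : ℕ → ℕ → Set
ComplementBound n k = Σ ℕ λ m → Σ (NGBW m n k) λ A →
  ∀ (s k' : ℕ) (B : NGBW m s k') → AcceptsComplementOf B A → (1 * n * k) ^ n ≤ 768 ^ n * s

-- Here the left side is at most `768 ^ n`, so one state suffices. An automaton with empty language
-- forces it, since its complement has a run.
complementBound-small : ∀ n k → n * k ≤ 768 → ComplementBound n k
complementBound-small n k nk≤768 = 1 , A , bound
  where
  A : NGBW 1 n k
  A = record { initial = λ _ → false ; trans = λ _ _ _ → false ; accSet = λ _ _ → false }

  inhabited : ∀ {s} → Fin s → 1 ≤ s
  inhabited {suc s} _ = s≤s z≤n

  bound : ∀ s k' (B : NGBW 1 s k') → AcceptsComplementOf B A → (1 * n * k) ^ n ≤ 768 ^ n * s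
  bound s k' B complement = begin
    (1 * n * k) ^ n ≡⟨ cong (λ t → (t * k) ^ n) (*-identityˡ n) ⟩
    (n * k) ^ n     ≤⟨ ^-monoˡ-≤ n nk≤768 ⟩
    768 ^ n         ≡⟨ *-identityʳ _ ⟨
    768 ^ n * 1     ≤⟨ *-monoʳ-≤ (768 ^ n) (inhabited (ρ 0)) ⟩
    768 ^ n * s     ∎
    where
    open ≤-Reasoning
    ρ = proj₁ (proj₂ (complement (λ _ → zero)) λ { (_ , (() , _) , _) })

module _ (r : ℕ) where

  private
    j = r / 2

  [4+r]/2 : (4 + r) / 2 ≡ 2 + j
  [4+r]/2 = ≡-trans (m/n≡1+[m∸n]/n {4 + r} {2} (s≤s (s≤s z≤n))) (cong suc (m/n≡1+[m∸n]/n {2 + r} {2} (s≤s (s≤s z≤n))))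

  -- With `n = 5 + r`, setting aside `aside`, `flash` and the common element 0 of the family leaves
  -- `n - 3` elements. The two steps down Pascal's triangle lose factors 3 and 4, whence the 12.
  central-C-ratio : (4 + r) C ((4 + r) / 2) ≤ 12 * ((2 + r) C j)
  central-C-ratio = begin
    (4 + r) C ((4 + r) / 2)   ≡⟨ cong ((4 + r) C_) [4+r]/2 ⟩
    (4 + r) C (2 + j)         ≤⟨ C-ratio 3 (3 + r) (1 + j) ratio₁ ⟩
    3 * ((3 + r) C (1 + j))   ≤⟨ *-monoʳ-≤ 3 (C-ratio 4 (2 + r) j ratio₂) ⟩
    3 * (4 * ((2 + r) C j))   ≡⟨ *-assoc 3 4 ((2 + r) C j) ⟨
    12 * ((2 + r) C j)        ∎
    where
    open ≤-Reasoning
    ratio₁ : 4 + r ≤ 3 * (2 + j)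
    ratio₁ = begin
      4 + r             ≤⟨ +-monoʳ-≤ 4 (n≤1+2[n/2] r) ⟩
      4 + (1 + j * 2)   ≤⟨ m≤m+n _ (1 + j) ⟩
      4 + (1 + j * 2) + (1 + j) ≡⟨ ring j ⟩
      3 * (2 + j)       ∎
      where
      ring : ∀ j → 4 + (1 + j * 2) + (1 + j) ≡ 3 * (2 + j)
      ring = solve-∀
    ratio₂ : 3 + r ≤ 4 * (1 + j)
    ratio₂ = begin
      3 + r             ≤⟨ +-monoʳ-≤ 3 (n≤1+2[n/2] r) ⟩
      3 + (1 + j * 2)   ≤⟨ m≤m+n _ (j * 2) ⟩
      3 + (1 + j * 2) + j * 2 ≡⟨ ring j ⟩
      4 * (1 + j)       ∎
      where
      ring : ∀ j → 3 + (1 + j * 2) + j * 2 ≡ 4 * (1 + j)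
      ring = solve-∀

k≤12[k/2] : ∀ k → 1 < k → k ≤ 12 * (k / 2)
k≤12[k/2] k 1<k with k / 2 | n≤1+2[n/2] k
... | zero  | le = contradiction 1<k (≤⇒≯ le)
... | suc h | le = ≤-trans le (≤-trans (m≤m+n _ (9 + 10 * h)) (≤-reflexive (ring h)))
  where
  ring : ∀ h → 1 + suc h * 2 + (9 + 10 * h) ≡ 12 * suc h
  ring = solve-∀

complementBound-family : ∀ P j k K → j + j < P → K ≤ P C j → 1 < k → K * 2 ≤ k → k ≤ 12 * K → k ≤ 2 ^ (3 + P) →
                         ComplementBound (3 + P) k
complementBound-family P j k zero    2j<P K≤ 1<k 2K≤k k≤12K k≤2^n = contradiction k≤12K (<⇒≱ (≤-trans (s≤s z≤n) 1<k))
complementBound-family P j k (suc K) 2j<P K≤ 1<k 2K≤k k≤12K k≤2^n =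
  _ , automaton , λ s k' B complement →
    count-bound (3 + P) (suc P) k (suc K) s refl k≤12K k≤2^n (complement-large code code-conflict B complement)
  where
  family = independent-family P j 2j<P (suc K) K≤
  retract = signed-retract {suc K} {k} (s≤s z≤n) 2K≤k

  open Separation {suc P} {suc K} {k} zero (proj₁ family) (proj₂ family)
    (proj₁ retract) (proj₁ (proj₂ retract)) (proj₂ (proj₂ retract))

≤12*-⊓ : ∀ {k} a b → k ≤ 12 * a → k ≤ 12 * b → k ≤ 12 * (a ⊓ b)
≤12*-⊓ {k} a b k≤a k≤b = subst (k ≤_) (sym (*-distribˡ-⊓ 12 a b)) (⊓-glb k≤a k≤b)

complementBound-large : ∀ r k → 1 < k → k ≤ (4 + r) C ((4 + r) / 2) → ComplementBound (5 + r) k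
-- The number of sets is capped by `k / 2`, as each set takes two indices, and by the size `X` of
-- the family; both are at least `k` over 12.
complementBound-large r k 1<k k≤C = complementBound-family (2 + r) j k (k / 2 ⊓ X)
  2j<P (m⊓n≤n (k / 2) X) 1<k
  (≤-trans (*-monoˡ-≤ 2 (m⊓n≤m (k / 2) X)) (m/n*n≤m k 2))
  (≤12*-⊓ (k / 2) X (k≤12[k/2] k 1<k) (≤-trans k≤C (central-C-ratio r)))
  (≤-trans (≤-trans k≤C (C≤2^ (4 + r) ((4 + r) / 2))) (^-monoʳ-≤ 2 (n≤1+n (4 + r))))
  where
  j = r / 2
  X = (2 + r) C j

  2j<P : j + j < 2 + r
  2j<P = s≤s (≤-trans (≤-trans (≤-reflexive (ring j)) (m/n*n≤m r 2)) (n≤1+n r))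
    where
    ring : ∀ j → j + j ≡ j * 2
    ring = solve-∀

complementBound : ∀ n k → 1 < n → 1 < k → k ≤ (n ∸ 1) C ((n ∸ 1) / 2) → ComplementBound n k
-- For `n` equal to 2, 3 and 4 the central binomials are 1, 2 and 3, so `n * k` is at most 2, 6 and
-- 12.
complementBound (suc (suc zero)) k _ _ k≤ = complementBound-small 2 k (≤-trans (*-monoʳ-≤ 2 k≤) (m≤m+n 2 766))
complementBound (suc (suc (suc zero))) k _ _ k≤ = complementBound-small 3 k (≤-trans (*-monoʳ-≤ 3 k≤) (m≤m+n 6 762))
complementBound (suc (suc (suc (suc zero)))) k _ _ k≤ = complementBound-small 4 k (≤-trans (*-monoʳ-≤ 4 k≤) (m≤m+n 12 756))
complementBound (suc (suc (suc (suc (suc r))))) k _ 1<k k≤ = complementBound-large r k 1<k k≤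
complementBound (suc zero) k (s≤s ()) _ _

theorem5p10 : Σ ℕ λ p → Σ ℕ λ q → (0 < p) × (0 < q) ×
    (∀ (n k : ℕ) → 1 < n → 1 < k → k ≤ (n ∸ 1) C ((n ∸ 1) / 2) →
    Σ ℕ λ m → Σ (NGBW m n k) λ A →
    ∀ (s k' : ℕ) (B : NGBW m s k') → AcceptsComplementOf B A →
    (p * n * k) ^ n ≤ q ^ n * s)
theorem5p10 = 1 , 768 , s≤s z≤n , s≤s z≤n , complementBound
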